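{- For every $\epsilon>0$, Algorithm $A1$ with $(p,k)=(2,4)$ (and its packing accuracy parameter chosen sufficiently small) is an asymptotic $(1.5+\epsilon)$-approximation algorithm for $(2,4)$-uniform unweighted set cover.
   Context: $(p,k)$-uniform unweighted set cover ($(p,k)$-UUSC): given $n$ base elements and a finite collection of subsets of them, each of size between $p$ and $k$, such that all subsets of size $p$ belong to the collection, find a subcollection of minimum cardinality covering all base elements. The collection is treated as subset-closed (every subset of an available set is also available), so covers may be taken to consist of pairwise disjoint sets. $|OPT|$ is the minimum cardinality of a cover. Algorithm $A1$, with accuracy parameter $\epsilon'>0$: during the execution an $i$-set is an available subset of size $i$ all of whose elements are still uncovered. For $i=k$ down to $p+1$ (packing phases): find a maximal (with respect to inclusion) collection of pairwise disjoint $i$-sets using a polynomial-time $\frac{2-\epsilon'}{i}$-approximation algorithm for maximizing the number of disjoint $i$-sets (i.e. the collection found has at least $\frac{2-\epsilon'}{i}$ times the maximum possible number of disjoint $i$-sets; such an algorithm is due to Hurkens and Schrijver), and add it to the cover. Phase $p$: cover the remaining base elements by disjoint $p$-sets, and possibly one additional set of size less than $p$ covering the leftover elements. An algorithm is an asymptotic $r$-approximation algorithm if the limit superior, as $|OPT|\to\infty$, of the worst-case ratio between the size of the cover it returns and $|OPT|$ is at most $r$. -}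

module Defs where

open import Data.Nat using (ℕ; suc; _≤_; _<_; NonZero)
open import Data.Integer using (+_)
open import Data.Rational using (ℚ; 0ℚ; _/_; _+_; _*_; _-_)
  renaming (_≤_ to _≤ℚ_; _<_ to _<ℚ_)
open import Data.Fin.Subset
  using (Subset; ⊤; ⋃; _∩_; _─_; ∣_∣; Empty; Nonempty; _⊆_)
  renaming (_∈_ to _∈ₛ_)
open import Data.List using (List; _∷_; _++_; length)
open import Data.List.Membership.Propositional using (_∈_)
open import Data.List.Relation.Unary.All using (All)
open import Data.List.Relation.Unary.AllPairs using (AllPairs)
open import Data.List.Relation.Unary.Unique.Propositional using (Unique)
open import Data.Product using (Σ-syntax; ∃-syntax; _×_)
open import Relation.Nullary using (¬_)
open import Relation.Binary.PropositionalEquality using (_≡_)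

ℕ→ℚ : ℕ → ℚ
ℕ→ℚ m = + m / 1

-- Instances of (p,k)-uniform unweighted set cover on the base set Fin n.
record UUSC (p k : ℕ) : Set where
  field
    n            : ℕ
    collection   : List (Subset n)
    size-bounds  : ∀ {S} → S ∈ collection → p ≤ ∣ S ∣ × ∣ S ∣ ≤ k
    all-p-sets   : ∀ S → ∣ S ∣ ≡ p → S ∈ collection

  -- The subset-closure of the collection.
  Available : Subset n → Set
  Available S = ∃[ T ] (T ∈ collection × S ⊆ T)

open UUSC public using (n)

module _ {p k : ℕ} (I : UUSC p k) where
  open UUSC I using (Available)

  -- A subcollection is a duplicate-free list, so its cardinality is its length.
  record IsCover (C : List (Subset (n I))) : Set where
    field
      unique    : Unique C
      available : All Available C
      covers    : ∀ x → x ∈ₛ ⋃ C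

  IsMinimumCover : List (Subset (n I)) → Set
  IsMinimumCover O = IsCover O × (∀ C → IsCover C → length O ≤ length C)

  Disjoint : Subset (n I) → Subset (n I) → Set
  Disjoint S T = Empty (S ∩ T)

  -- i-sets, where U is the set of elements that are still uncovered.
  record Is-Set (i : ℕ) (U S : Subset (n I)) : Set where
    field
      available : Available S
      uncovered : S ⊆ U
      size      : ∣ S ∣ ≡ i

  record IsPacking (i : ℕ) (U : Subset (n I)) (P : List (Subset (n I))) : Set where
    field
      i-sets   : All (Is-Set i U) P
      disjoint : AllPairs Disjoint P

  -- The possible results of the packing subroutine: packings that are maximal
  -- under inclusion and have at least (2 - ε′)/i times as many sets as any
  -- packing.
  record IsPackingOutput (ε′ : ℚ) (i : ℕ) .{{_ : NonZero i}}
                         (U : Subset (n I)) (P : List (Subset (n I))) : Set where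
    field
      packing       : IsPacking i U P
      maximal       : ∀ S → Is-Set i U S → ¬ All (Disjoint S) P
      approximation : ∀ P* → IsPacking i U P* →
                      (ℕ→ℚ 2 - ε′) * (+ 1 / i) * ℕ→ℚ (length P*) ≤ℚ ℕ→ℚ (length P)

  -- The last phase.  The availability of the leftover set is automatic as soon
  -- as p ≤ n, since every set with fewer than p elements then lies in a p-set.
  data FinalPhase (U : Subset (n I)) : List (Subset (n I)) → Set where
    no-leftover : ∀ {P} → IsPacking p U P → Empty (U ─ ⋃ P) → FinalPhase U P
    leftover    : ∀ {P} → IsPacking p U P →
                  let L = U ─ ⋃ P in
                  Nonempty L → ∣ L ∣ < p → Available L → FinalPhase U (L ∷ P)

  -- Run ε′ i U C : phases i, i - 1, …, p, started when exactly the elements of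
  -- U are uncovered, can add the sets C to the cover.
  data Run (ε′ : ℚ) : ℕ → Subset (n I) → List (Subset (n I)) → Set where
    final   : ∀ {U C} → FinalPhase U C → Run ε′ p U C
    packing : ∀ {i U P C} → p < suc i → IsPackingOutput ε′ (suc i) U P →
              Run ε′ i (U ─ ⋃ P) C → Run ε′ (suc i) U (P ++ C)

-- An algorithm is given by its input/output relation: it may return different
-- covers of the same instance, depending on the choices it makes.
Algorithm : ℕ → ℕ → Set₁
Algorithm p k = (I : UUSC p k) → List (Subset (n I)) → Set

A1 : (p k : ℕ) → ℚ → Algorithm p k
A1 p k ε′ I = Run I ε′ k ⊤

-- The bound says that the limit superior of the worst-case ratio
-- length C / length O is at most r, with the denominator cleared.
record IsAsymptoticApproximation {p k : ℕ} (A : Algorithm p k) (r : ℚ) : Set where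
  field
    feasible : ∀ I C → A I C → IsCover I C
    limsup≤  : ∀ δ → 0ℚ <ℚ δ → Σ[ N ∈ ℕ ] (∀ I O C →
               IsMinimumCover I O → A I C → N ≤ length O →
               ℕ→ℚ (length C) ≤ℚ (r + δ) * ℕ→ℚ (length O))

{-# OPTIONS --safe #-}
module Submission where

-- Disjointify an optimal cover O greedily.  Its pieces with four elements form a
-- packing with q ≤ |O| sets, and all other pieces have at most three elements, so
-- n ≤ 3|O| + q.  If A1 chooses a sets in phase 4, then its cover C satisfies
-- |C| ≤ (n − 2a + 1)/2, because the sets of the later phases, except possibly
-- one, have at least two elements.  Since a ≥ (2 − ε′)q/4, this gives
-- |C| ≤ 3/2 |O| + 1/2 + ε′q/4.

open import Data.Bool using (true; false)
open import Data.Fin using (Fin)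
open import Data.Fin.Subset
  using (Subset; ⊤; ⋃; _∩_; _∪_; _─_; ∣_∣; Empty; Nonempty; _⊆_)
  renaming (_∈_ to _∈ₛ_; _∉_ to _∉ₛ_)
open import Data.Fin.Subset.Properties
open import Data.Integer as ℤ using (+_)
import Data.Integer.Properties as ℤ
open import Data.List using (List; []; _∷_; _++_; length)
open import Data.List.Properties using (length-++)
open import Data.List.Relation.Unary.All as All using (All; []; _∷_)
import Data.List.Relation.Unary.All.Properties as All
open import Data.List.Relation.Unary.AllPairs as AllPairs using (AllPairs; []; _∷_)
import Data.List.Relation.Unary.AllPairs.Properties as AllPairs
open import Data.List.Relation.Unary.Any as Any using (Any; here; there)
import Data.List.Relation.Unary.Any.Properties as Any
open import Data.List.Relation.Unary.Unique.Propositional using (Unique)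
open import Data.Nat as ℕ using (ℕ; suc; NonZero)
import Data.Nat.Properties as ℕ
import Data.Nat.Solver as ℕ
open import Data.Product using (∃-syntax; Σ-syntax; _×_; _,_; proj₁; proj₂)
open import Data.Rational
  using (ℚ; mkℚ; 0ℚ; 1ℚ; ½; _/_; _+_; _*_; _-_; _<_; _≤_; *<*; toℚᵘ; nonNegative)
open import Data.Rational.Properties
open import Data.Rational.Solver using (module +-*-Solver)
open import Data.Rational.Unnormalised as ℚᵘ using (mkℚᵘ)
import Data.Rational.Unnormalised.Properties as ℚᵘ
open import Data.Sum using (inj₁; inj₂)
open import Data.Vec using ([]; _∷_; here; there)
open import Function using (_∘_)
open import Relation.Binary.PropositionalEquality
open import Relation.Nullary using (yes; no; contradiction)
open import Relation.Nullary.Decidable using (from-yes)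
open import Defs

-- Cardinalities of differences and unions of finite subsets.

∣p─q∣+∣p∩q∣≡∣p∣ : ∀ {n} (p q : Subset n) → ∣ p ─ q ∣ ℕ.+ ∣ p ∩ q ∣ ≡ ∣ p ∣
∣p─q∣+∣p∩q∣≡∣p∣ []          []          = refl
∣p─q∣+∣p∩q∣≡∣p∣ (true ∷ p)  (true ∷ q)  = trans (ℕ.+-suc _ _) (cong suc (∣p─q∣+∣p∩q∣≡∣p∣ p q))
∣p─q∣+∣p∩q∣≡∣p∣ (true ∷ p)  (false ∷ q) = cong suc (∣p─q∣+∣p∩q∣≡∣p∣ p q)
∣p─q∣+∣p∩q∣≡∣p∣ (false ∷ p) (true ∷ q)  = ∣p─q∣+∣p∩q∣≡∣p∣ p q
∣p─q∣+∣p∩q∣≡∣p∣ (false ∷ p) (false ∷ q) = ∣p─q∣+∣p∩q∣≡∣p∣ p q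

∣p∪q∣≡∣p─q∣+∣q∣ : ∀ {n} (p q : Subset n) → ∣ p ∪ q ∣ ≡ ∣ p ─ q ∣ ℕ.+ ∣ q ∣
∣p∪q∣≡∣p─q∣+∣q∣ []          []          = refl
∣p∪q∣≡∣p─q∣+∣q∣ (true ∷ p)  (true ∷ q)  = trans (cong suc (∣p∪q∣≡∣p─q∣+∣q∣ p q)) (sym (ℕ.+-suc _ _))
∣p∪q∣≡∣p─q∣+∣q∣ (true ∷ p)  (false ∷ q) = cong suc (∣p∪q∣≡∣p─q∣+∣q∣ p q)
∣p∪q∣≡∣p─q∣+∣q∣ (false ∷ p) (true ∷ q)  = trans (cong suc (∣p∪q∣≡∣p─q∣+∣q∣ p q)) (sym (ℕ.+-suc _ _))
∣p∪q∣≡∣p─q∣+∣q∣ (false ∷ p) (false ∷ q) = ∣p∪q∣≡∣p─q∣+∣q∣ p q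

x∈p─q⇒x∉q : ∀ {n} {x : Fin n} (p q : Subset n) → x ∈ₛ p ─ q → x ∉ₛ q
x∈p─q⇒x∉q (true ∷ _) (false ∷ _) here ()
x∈p─q⇒x∉q (_ ∷ p) (_ ∷ q) (there x∈p─q) (there x∈q) = x∈p─q⇒x∉q p q x∈p─q x∈q

Empty⇒∣p∣≡0 : ∀ {n} {p : Subset n} → Empty p → ∣ p ∣ ≡ 0
Empty⇒∣p∣≡0 {n} ∅ = trans (cong ∣_∣ (Empty-unique ∅)) (∣⊥∣≡0 n)

Nonempty⇒∣p∣>0 : ∀ {n} {p : Subset n} → Nonempty p → 0 ℕ.< ∣ p ∣
Nonempty⇒∣p∣>0 (_ , x∈p) = ℕ.≤-<-trans ℕ.z≤n (x∈p⇒∣p-x∣<∣p∣ x∈p)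

∣p∣>0⇒Nonempty : ∀ {n} {p : Subset n} → 0 ℕ.< ∣ p ∣ → Nonempty p
∣p∣>0⇒Nonempty {p = p} 0<∣p∣ with nonempty? p
... | yes ne = ne
... | no  ∅  = contradiction (sym (Empty⇒∣p∣≡0 ∅)) (ℕ.<⇒≢ 0<∣p∣)

∣p∪q∣≡∣p∣+∣q∣ : ∀ {n} (p q : Subset n) → Empty (p ∩ q) → ∣ p ∪ q ∣ ≡ ∣ p ∣ ℕ.+ ∣ q ∣
∣p∪q∣≡∣p∣+∣q∣ p q ∅ = trans (∣p∪q∣≡∣p─q∣+∣q∣ p q) (cong (ℕ._+ ∣ q ∣) (begin
  ∣ p ─ q ∣                ≡⟨ ℕ.+-identityʳ _ ⟨
  ∣ p ─ q ∣ ℕ.+ 0          ≡⟨ cong (∣ p ─ q ∣ ℕ.+_) (Empty⇒∣p∣≡0 ∅) ⟨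
  ∣ p ─ q ∣ ℕ.+ ∣ p ∩ q ∣  ≡⟨ ∣p─q∣+∣p∩q∣≡∣p∣ p q ⟩
  ∣ p ∣                    ∎))
  where open ≡-Reasoning

q⊆p⇒∣q∣+∣p─q∣≡∣p∣ : ∀ {n} (p q : Subset n) → q ⊆ p → ∣ q ∣ ℕ.+ ∣ p ─ q ∣ ≡ ∣ p ∣
q⊆p⇒∣q∣+∣p─q∣≡∣p∣ p q q⊆p = begin
  ∣ q ∣ ℕ.+ ∣ p ─ q ∣      ≡⟨ ℕ.+-comm ∣ q ∣ _ ⟩
  ∣ p ─ q ∣ ℕ.+ ∣ q ∣      ≡⟨ cong (λ r → ∣ p ─ q ∣ ℕ.+ ∣ r ∣) p∩q≡q ⟨
  ∣ p ─ q ∣ ℕ.+ ∣ p ∩ q ∣  ≡⟨ ∣p─q∣+∣p∩q∣≡∣p∣ p q ⟩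
  ∣ p ∣                    ∎
  where
  open ≡-Reasoning
  p∩q≡q : p ∩ q ≡ q
  p∩q≡q = ⊆-antisym (p∩q⊆q p q) (λ x∈q → x∈p∩q⁺ (q⊆p x∈q , x∈q))

q∪[p─q]≡p : ∀ {n} {p q : Subset n} → q ⊆ p → q ∪ (p ─ q) ≡ p
q∪[p─q]≡p {p = p} {q} q⊆p = ⊆-antisym to from
  where
  to : q ∪ (p ─ q) ⊆ p
  to x∈ with x∈p∪q⁻ q (p ─ q) x∈
  ... | inj₁ x∈q   = q⊆p x∈q
  ... | inj₂ x∈p─q = p─q⊆p p q x∈p─q
  from : p ⊆ q ∪ (p ─ q)
  from {x} x∈p with x ∈? q
  ... | yes x∈q = x∈p∪q⁺ (inj₁ x∈q)
  ... | no  x∉q = x∈p∪q⁺ (inj₂ (x∈p∧x∉q⇒x∈p─q x∈p x∉q))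

Empty-[p─q]∩q : ∀ {n} (p q : Subset n) → Empty ((p ─ q) ∩ q)
Empty-[p─q]∩q p q (_ , x∈) with x∈p─q , x∈q ← x∈p∩q⁻ (p ─ q) q x∈ = x∈p─q⇒x∉q p q x∈p─q x∈q

-- Membership in the union of a list.

⋃⁺ : ∀ {n} {x : Fin n} {P} → Any (x ∈ₛ_) P → x ∈ₛ ⋃ P
⋃⁺ (here x∈S)  = x∈p∪q⁺ (inj₁ x∈S)
⋃⁺ (there x∈P) = x∈p∪q⁺ (inj₂ (⋃⁺ x∈P))

⋃⁻ : ∀ {n} {x : Fin n} P → x ∈ₛ ⋃ P → Any (x ∈ₛ_) P
⋃⁻ []      x∈⊥ = contradiction x∈⊥ ∉⊥
⋃⁻ (S ∷ P) x∈  with x∈p∪q⁻ S (⋃ P) x∈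
... | inj₁ x∈S = here x∈S
... | inj₂ x∈P = there (⋃⁻ P x∈P)

⋃-⊆ : ∀ {n} {U : Subset n} {P} → All (_⊆ U) P → ⋃ P ⊆ U
⋃-⊆ {P = P} P⊆U x∈⋃P = All.lookupWith (λ S⊆U x∈S → S⊆U x∈S) P⊆U (⋃⁻ P x∈⋃P)

module _ {p k : ℕ} (I : UUSC p k) where
  open UUSC I using (Available; size-bounds)

  -- Counting elements in packings and runs.

  Disjoint-⋃ : ∀ {S P} → All (Disjoint I S) P → Disjoint I S (⋃ P)
  Disjoint-⋃ {S} {P} S∥P (x , x∈) with x∈S , x∈⋃P ← x∈p∩q⁻ S (⋃ P) x∈ =
    All.lookupWith (λ S∥T x∈T → S∥T (x , x∈p∩q⁺ (x∈S , x∈T))) S∥P (⋃⁻ P x∈⋃P)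

  Is-Set-⊆ : ∀ {i U V S} → U ⊆ V → Is-Set I i U S → Is-Set I i V S
  Is-Set-⊆ U⊆V s = record
    { available = available ; uncovered = U⊆V ∘ uncovered ; size = size }
    where open Is-Set s

  IsPacking-⊆ : ∀ {i U V P} → U ⊆ V → IsPacking I i U P → IsPacking I i V P
  IsPacking-⊆ U⊆V π = record
    { i-sets = All.map (Is-Set-⊆ U⊆V) (IsPacking.i-sets π)
    ; disjoint = IsPacking.disjoint π }

  ∣⋃∣-packing : ∀ {i P} → All (λ S → ∣ S ∣ ≡ i) P → AllPairs (Disjoint I) P →
                ∣ ⋃ P ∣ ≡ i ℕ.* length P
  ∣⋃∣-packing {i} [] [] = trans (∣⊥∣≡0 (n I)) (sym (ℕ.*-zeroʳ i))
  ∣⋃∣-packing {i} {S ∷ P} (∣S∣≡i ∷ szs) (S∥P ∷ ds) = begin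
    ∣ S ∪ ⋃ P ∣              ≡⟨ ∣p∪q∣≡∣p∣+∣q∣ S (⋃ P) (Disjoint-⋃ S∥P) ⟩
    ∣ S ∣ ℕ.+ ∣ ⋃ P ∣        ≡⟨ cong₂ ℕ._+_ ∣S∣≡i (∣⋃∣-packing szs ds) ⟩
    i ℕ.+ i ℕ.* length P     ≡⟨ ℕ.*-suc i (length P) ⟨
    i ℕ.* suc (length P)     ∎
    where open ≡-Reasoning

  IsPacking-⋃⊆ : ∀ {i U P} → IsPacking I i U P → ⋃ P ⊆ U
  IsPacking-⋃⊆ π = ⋃-⊆ (All.map (λ s {x} → Is-Set.uncovered s {x}) (IsPacking.i-sets π))

  packing-size : ∀ {i U P} → IsPacking I i U P →
                 i ℕ.* length P ℕ.+ ∣ U ─ ⋃ P ∣ ≡ ∣ U ∣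
  packing-size {i} {U} {P} π = begin
    i ℕ.* length P ℕ.+ ∣ U ─ ⋃ P ∣  ≡⟨ cong (ℕ._+ ∣ U ─ ⋃ P ∣) (∣⋃∣-packing (All.map Is-Set.size i-sets) disjoint) ⟨
    ∣ ⋃ P ∣ ℕ.+ ∣ U ─ ⋃ P ∣         ≡⟨ q⊆p⇒∣q∣+∣p─q∣≡∣p∣ U (⋃ P) (IsPacking-⋃⊆ π) ⟩
    ∣ U ∣                           ∎
    where
    open ≡-Reasoning
    open IsPacking π

  -- Only the leftover set can have fewer than `p` elements, and being nonempty it has at least one.
  -- Rounding it up to `p` thus costs at most `p` minus 1, which is why the inequality is strict.
  -- Without a leftover set, strictness comes from `p` being nonzero.
  FinalPhase-size : ∀ {U C} .{{_ : NonZero p}} → FinalPhase I U C →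
                    p ℕ.* length C ℕ.< ∣ U ∣ ℕ.+ p
  FinalPhase-size {U} {P} (no-leftover π _) = begin-strict
    p ℕ.* length P                  ≤⟨ ℕ.m≤m+n _ _ ⟩
    p ℕ.* length P ℕ.+ ∣ U ─ ⋃ P ∣  ≡⟨ packing-size π ⟩
    ∣ U ∣                           <⟨ ℕ.m<m+n ∣ U ∣ (ℕ.>-nonZero⁻¹ p) ⟩
    ∣ U ∣ ℕ.+ p                     ∎
    where open ℕ.≤-Reasoning
  FinalPhase-size {U} (leftover {P} π L≢∅ _ _) = begin-strict
    p ℕ.* suc (length P)                    ≡⟨ ℕ.*-suc p (length P) ⟩
    p ℕ.+ p ℕ.* length P                    ≡⟨ ℕ.+-comm p _ ⟩
    p ℕ.* length P ℕ.+ p                    <⟨ ℕ.+-monoˡ-< p (ℕ.m<m+n _ (Nonempty⇒∣p∣>0 L≢∅)) ⟩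
    p ℕ.* length P ℕ.+ ∣ U ─ ⋃ P ∣ ℕ.+ p    ≡⟨ cong (ℕ._+ p) (packing-size π) ⟩
    ∣ U ∣ ℕ.+ p                             ∎
    where open ℕ.≤-Reasoning

  -- The sets of a packing phase have more than `p` elements, so charging each of them only `p`
  -- loses nothing. The additive slack arises in the final phase alone and does not accumulate over
  -- the phases.
  Run-size : ∀ {ε′ i U C} .{{_ : NonZero p}} → Run I ε′ i U C →
             p ℕ.* length C ℕ.< ∣ U ∣ ℕ.+ p
  Run-size (final φ) = FinalPhase-size φ
  Run-size (packing {i} {U} {P} {C} p<1+i out run) = begin-strict
    p ℕ.* length (P ++ C)                           ≡⟨ cong (p ℕ.*_) (length-++ P) ⟩
    p ℕ.* (length P ℕ.+ length C)                   ≡⟨ ℕ.*-distribˡ-+ p (length P) _ ⟩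
    p ℕ.* length P ℕ.+ p ℕ.* length C               <⟨ ℕ.+-mono-≤-< (ℕ.*-monoˡ-≤ (length P) (ℕ.<⇒≤ p<1+i)) (Run-size run) ⟩
    suc i ℕ.* length P ℕ.+ (∣ U ─ ⋃ P ∣ ℕ.+ p)      ≡⟨ ℕ.+-assoc (suc i ℕ.* length P) _ p ⟨
    suc i ℕ.* length P ℕ.+ ∣ U ─ ⋃ P ∣ ℕ.+ p        ≡⟨ cong (ℕ._+ p) (packing-size (IsPackingOutput.packing out)) ⟩
    ∣ U ∣ ℕ.+ p                                     ∎
    where open ℕ.≤-Reasoning

  -- Feasibility of the returned cover.

  -- Relative to a set `U`, so that the covers built by successive phases can be glued by induction
  -- on the run. Disjointness and nonemptiness are carried along because together they exclude
  -- duplicates.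
  record IsDisjointCover (U : Subset (n I)) (C : List (Subset (n I))) : Set where
    field
      available : All Available C
      uncovered : All (_⊆ U) C
      nonempty  : All Nonempty C
      disjoint  : AllPairs (Disjoint I) C
      covers    : ∀ {x} → x ∈ₛ U → Any (x ∈ₛ_) C

  -- A packing need not exhaust `U`, so it is regarded as a cover of its own union; the rest of `U`
  -- is left to the later phases.
  IsPacking⇒IsDisjointCover : ∀ {i U P} .{{_ : NonZero i}} → IsPacking I i U P →
                              IsDisjointCover (⋃ P) P
  IsPacking⇒IsDisjointCover {i} {U} {P} π = record
    { available = All.map Is-Set.available i-sets
    ; uncovered = All.tabulate (λ S∈P x∈S → ⋃⁺ (Any.map (λ S≡T → subst (_ ∈ₛ_) S≡T x∈S) S∈P))
    ; nonempty  = All.map (λ s → ∣p∣>0⇒Nonempty (subst (0 ℕ.<_) (sym (Is-Set.size s)) (ℕ.>-nonZero⁻¹ i))) i-sets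
    ; disjoint  = disjoint
    ; covers    = ⋃⁻ P
    }
    where open IsPacking π

  [L]-IsDisjointCover : ∀ {L} → Available L → Nonempty L → IsDisjointCover L (L ∷ [])
  [L]-IsDisjointCover L-available L≢∅ = record
    { available = L-available ∷ []
    ; uncovered = ⊆-refl ∷ []
    ; nonempty  = L≢∅ ∷ []
    ; disjoint  = [] ∷ []
    ; covers    = here
    }

  IsDisjointCover-++ : ∀ {V W P C} → Disjoint I W V → IsDisjointCover V P →
                       IsDisjointCover W C → IsDisjointCover (V ∪ W) (P ++ C)
  IsDisjointCover-++ {V} {W} {P} {C} W∥V π γ = record
    { available = All.++⁺ π.available γ.available
    ; uncovered = All.++⁺ (All.map (λ S⊆V {x} x∈S → p⊆p∪q W (S⊆V x∈S)) π.uncovered)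
                          (All.map (λ S⊆W {x} x∈S → q⊆p∪q V W (S⊆W x∈S)) γ.uncovered)
    ; nonempty  = All.++⁺ π.nonempty γ.nonempty
    ; disjoint  = AllPairs.++⁺ π.disjoint γ.disjoint
        (All.map {P = _⊆ V} (λ S⊆V → All.map {P = _⊆ W} (λ T⊆W → disjoint S⊆V T⊆W) γ.uncovered) π.uncovered)
    ; covers    = covers
    }
    where
    module π = IsDisjointCover π
    module γ = IsDisjointCover γ
    disjoint : ∀ {S T} → S ⊆ V → T ⊆ W → Disjoint I S T
    disjoint {S} {T} S⊆V T⊆W (x , x∈S∩T) with x∈S , x∈T ← x∈p∩q⁻ S T x∈S∩T =
      W∥V (x , x∈p∩q⁺ (T⊆W x∈T , S⊆V x∈S))
    covers : ∀ {x} → x ∈ₛ V ∪ W → Any (x ∈ₛ_) (P ++ C)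
    covers x∈ with x∈p∪q⁻ V W x∈
    ... | inj₁ x∈V = Any.++⁺ˡ (π.covers x∈V)
    ... | inj₂ x∈W = Any.++⁺ʳ P (γ.covers x∈W)

  FinalPhase⇒IsDisjointCover : ∀ {U C} .{{_ : NonZero p}} → FinalPhase I U C → IsDisjointCover U C
  FinalPhase⇒IsDisjointCover {U} (no-leftover {P} π ∅) =
    subst (λ V → IsDisjointCover V P) ⋃P≡U (IsPacking⇒IsDisjointCover π)
    where
    open ≡-Reasoning
    ⋃P≡U : ⋃ P ≡ U
    ⋃P≡U = begin
      ⋃ P                ≡⟨ ∪-identityʳ (⋃ P) ⟨
      ⋃ P ∪ _            ≡⟨ cong (⋃ P ∪_) (Empty-unique ∅) ⟨
      ⋃ P ∪ (U ─ ⋃ P)    ≡⟨ q∪[p─q]≡p (IsPacking-⋃⊆ π) ⟩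
      U                  ∎
  FinalPhase⇒IsDisjointCover {U} (leftover {P} π L≢∅ _ L-available) =
    subst (λ V → IsDisjointCover V ((U ─ ⋃ P) ∷ P)) (trans (∪-comm _ _) (q∪[p─q]≡p (IsPacking-⋃⊆ π)))
      (IsDisjointCover-++ ⋃P∥L ([L]-IsDisjointCover L-available L≢∅) (IsPacking⇒IsDisjointCover π))
    where
    -- The leftover set is listed before the packing, so the two parts are glued in the opposite
    -- order from a packing phase, and disjointness has to be commuted.
    ⋃P∥L : Disjoint I (⋃ P) (U ─ ⋃ P)
    ⋃P∥L = subst Empty (∩-comm (U ─ ⋃ P) (⋃ P)) (Empty-[p─q]∩q U (⋃ P))

  Run⇒IsDisjointCover : ∀ {ε′ i U C} .{{_ : NonZero p}} → Run I ε′ i U C → IsDisjointCover U C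
  Run⇒IsDisjointCover (final φ) = FinalPhase⇒IsDisjointCover φ
  Run⇒IsDisjointCover (packing {U = U} {P} _ out run) =
    subst (λ V → IsDisjointCover V _) (q∪[p─q]≡p (IsPacking-⋃⊆ π))
      (IsDisjointCover-++ (Empty-[p─q]∩q U (⋃ P)) (IsPacking⇒IsDisjointCover π) (Run⇒IsDisjointCover run))
    where π = IsPackingOutput.packing out

  -- A nonempty set is not disjoint from itself.
  Unique-disjoint : ∀ {C} → All Nonempty C → AllPairs (Disjoint I) C → Unique C
  Unique-disjoint [] [] = []
  Unique-disjoint ((x , x∈S) ∷ C≢∅) (S∥C ∷ ds) =
    All.map (λ S∥T S≡T → S∥T (x , x∈p∩q⁺ (x∈S , subst (x ∈ₛ_) S≡T x∈S))) S∥C ∷ Unique-disjoint C≢∅ ds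

  Run⇒IsCover : ∀ {ε′ i C} .{{_ : NonZero p}} → Run I ε′ i ⊤ C → IsCover I C
  Run⇒IsCover run = record
    { unique    = Unique-disjoint nonempty disjoint
    ; available = available
    ; covers    = λ x → ⋃⁺ (covers ∈⊤)
    }
    where open IsDisjointCover (Run⇒IsDisjointCover run)

  -- A packing of `k`-sets extracted from an arbitrary cover.

  ∣Available∣≤k : ∀ {S} → Available S → ∣ S ∣ ℕ.≤ k
  ∣Available∣≤k (T , T∈ , S⊆T) = ℕ.≤-trans (p⊆q⇒∣p∣≤∣q∣ S⊆T) (proj₂ (size-bounds T∈))

  -- The count |⋃ O| ≤ (k − 1)|O| + |P|, without subtraction.
  packing-from-cover : ∀ O → All Available O →
    ∃[ P ] (IsPacking I k (⋃ O) P × length P ℕ.≤ length O ×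
            ∣ ⋃ O ∣ ℕ.+ length O ℕ.≤ k ℕ.* length O ℕ.+ length P)
  packing-from-cover [] [] =
    [] , record { i-sets = [] ; disjoint = [] } , ℕ.z≤n ,
    ℕ.≤-trans (ℕ.≤-reflexive (cong (ℕ._+ 0) (∣⊥∣≡0 (n I)))) ℕ.z≤n
  packing-from-cover (S ∷ O) (S-available@(T , T∈ , S⊆T) ∷ O-available)
    -- Each set keeps only the elements that no later set of the list covers. The piece kept by `S`
    -- joins the packing exactly when it still has full size `k`.
    with packing-from-cover O O-available | ∣ S ─ ⋃ O ∣ ℕ.≟ k
  ... | P , π , ∣P∣≤∣O∣ , bound | yes ∣S′∣≡k =
    (S ─ ⋃ O) ∷ P ,
    record { i-sets = s ∷ IsPacking.i-sets π′
           ; disjoint = All.map S′∥ (IsPacking.i-sets π) ∷ IsPacking.disjoint π } ,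
    ℕ.s≤s ∣P∣≤∣O∣ , size-bound
    where
    π′ : IsPacking I k (⋃ (S ∷ O)) P
    π′ = IsPacking-⊆ (q⊆p∪q S (⋃ O)) π
    S′-available : Available (S ─ ⋃ O)
    S′-available = T , T∈ , λ x∈ → S⊆T (p─q⊆p S (⋃ O) x∈)
    s : Is-Set I k (⋃ (S ∷ O)) (S ─ ⋃ O)
    s = record { available = S′-available
               ; uncovered = λ x∈ → p⊆p∪q (⋃ O) (p─q⊆p S (⋃ O) x∈)
               ; size = ∣S′∣≡k }
    -- The members of `P` lie inside `⋃ O`, which the new piece avoids. This needs the sharper
    -- containment recorded in `π`, not the weakened one in `π′`.
    S′∥ : ∀ {R} → Is-Set I k (⋃ O) R → Disjoint I (S ─ ⋃ O) R
    S′∥ {R} r (x , x∈) with x∈S′ , x∈R ← x∈p∩q⁻ (S ─ ⋃ O) R x∈ =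
      x∈p─q⇒x∉q S (⋃ O) x∈S′ (Is-Set.uncovered r x∈R)
    size-bound : ∣ S ∪ ⋃ O ∣ ℕ.+ suc (length O) ℕ.≤ k ℕ.* suc (length O) ℕ.+ suc (length P)
    size-bound = begin
      ∣ S ∪ ⋃ O ∣ ℕ.+ suc (length O)                   ≡⟨ cong (ℕ._+ suc (length O)) (∣p∪q∣≡∣p─q∣+∣q∣ S (⋃ O)) ⟩
      ∣ S ─ ⋃ O ∣ ℕ.+ ∣ ⋃ O ∣ ℕ.+ suc (length O)       ≡⟨ cong (λ s → s ℕ.+ ∣ ⋃ O ∣ ℕ.+ suc (length O)) ∣S′∣≡k ⟩
      k ℕ.+ ∣ ⋃ O ∣ ℕ.+ suc (length O)                 ≡⟨ solve 3 (λ k u o → k :+ u :+ (con 1 :+ o) := con 1 :+ k :+ (u :+ o)) refl k ∣ ⋃ O ∣ (length O) ⟩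
      suc k ℕ.+ (∣ ⋃ O ∣ ℕ.+ length O)                 ≤⟨ ℕ.+-monoʳ-≤ (suc k) bound ⟩
      suc k ℕ.+ (k ℕ.* length O ℕ.+ length P)          ≡⟨ solve 3 (λ k o q → con 1 :+ k :+ (k :* o :+ q) := k :* (con 1 :+ o) :+ (con 1 :+ q)) refl k (length O) (length P) ⟩
      k ℕ.* suc (length O) ℕ.+ suc (length P)          ∎
      where
      open ℕ.≤-Reasoning
      open ℕ.+-*-Solver
  ... | P , π , ∣P∣≤∣O∣ , bound | no ∣S′∣≢k =
    P , IsPacking-⊆ (q⊆p∪q S (⋃ O)) π , ℕ.m≤n⇒m≤1+n ∣P∣≤∣O∣ , size-bound
    where
    ∣S′∣<k : ∣ S ─ ⋃ O ∣ ℕ.< k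
    ∣S′∣<k = ℕ.≤∧≢⇒< (ℕ.≤-trans (∣p─q∣≤∣p∣ S (⋃ O)) (∣Available∣≤k S-available)) ∣S′∣≢k
    size-bound : ∣ S ∪ ⋃ O ∣ ℕ.+ suc (length O) ℕ.≤ k ℕ.* suc (length O) ℕ.+ length P
    size-bound = begin
      ∣ S ∪ ⋃ O ∣ ℕ.+ suc (length O)                   ≡⟨ cong (ℕ._+ suc (length O)) (∣p∪q∣≡∣p─q∣+∣q∣ S (⋃ O)) ⟩
      ∣ S ─ ⋃ O ∣ ℕ.+ ∣ ⋃ O ∣ ℕ.+ suc (length O)       ≡⟨ solve 3 (λ s u o → s :+ u :+ (con 1 :+ o) := con 1 :+ s :+ (u :+ o)) refl ∣ S ─ ⋃ O ∣ ∣ ⋃ O ∣ (length O) ⟩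
      -- A piece that is not full has at most `k` minus 1 elements, which leaves room for the unit
      -- contributed on the left by counting `S` itself.
      suc ∣ S ─ ⋃ O ∣ ℕ.+ (∣ ⋃ O ∣ ℕ.+ length O)       ≤⟨ ℕ.+-mono-≤ ∣S′∣<k bound ⟩
      k ℕ.+ (k ℕ.* length O ℕ.+ length P)              ≡⟨ solve 3 (λ k o q → k :+ (k :* o :+ q) := k :* (con 1 :+ o) :+ q) refl k (length O) (length P) ⟩
      k ℕ.* suc (length O) ℕ.+ length P                ∎
      where
      open ℕ.≤-Reasoning
      open ℕ.+-*-Solver

-- Naturals inside the rationals.

-- The gcd normalisation in `_/_` does not compute on variables, so both sides are compared as
-- unnormalised fractions with denominator 1.
ℕ→ℚ-homo-+ : ∀ a b → ℕ→ℚ (a ℕ.+ b) ≡ ℕ→ℚ a + ℕ→ℚ b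
ℕ→ℚ-homo-+ a b = toℚᵘ-injective (begin-equality
  toℚᵘ (ℕ→ℚ (a ℕ.+ b))                    ≃⟨ toℚᵘ-fromℚᵘ _ ⟩
  mkℚᵘ (+ (a ℕ.+ b)) 0                    ≃⟨ ℚᵘ.*≡* (cong₂ (λ x y → (x ℤ.+ y) ℤ.* ℤ.1ℤ) (sym (ℤ.*-identityʳ (+ a))) (sym (ℤ.*-identityʳ (+ b)))) ⟩
  mkℚᵘ (+ a) 0 ℚᵘ.+ mkℚᵘ (+ b) 0          ≃⟨ ℚᵘ.+-cong (toℚᵘ-fromℚᵘ (mkℚᵘ (+ a) 0)) (toℚᵘ-fromℚᵘ (mkℚᵘ (+ b) 0)) ⟨
  toℚᵘ (ℕ→ℚ a) ℚᵘ.+ toℚᵘ (ℕ→ℚ b)          ≃⟨ toℚᵘ-homo-+ (ℕ→ℚ a) (ℕ→ℚ b) ⟨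
  toℚᵘ (ℕ→ℚ a + ℕ→ℚ b)                    ∎)
  where open ℚᵘ.≤-Reasoning

ℕ→ℚ-mono-≤ : ∀ {a b} → a ℕ.≤ b → ℕ→ℚ a ≤ ℕ→ℚ b
ℕ→ℚ-mono-≤ {a} {b} a≤b = toℚᵘ-cancel-≤ (begin
  toℚᵘ (ℕ→ℚ a)    ≃⟨ toℚᵘ-fromℚᵘ (mkℚᵘ (+ a) 0) ⟩
  mkℚᵘ (+ a) 0    ≤⟨ ℚᵘ.*≤* (ℤ.*-monoʳ-≤-nonNeg ℤ.1ℤ (ℤ.+≤+ a≤b)) ⟩
  mkℚᵘ (+ b) 0    ≃⟨ toℚᵘ-fromℚᵘ (mkℚᵘ (+ b) 0) ⟨
  toℚᵘ (ℕ→ℚ b)    ∎)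
  where open ℚᵘ.≤-Reasoning

archimedean : ∀ δ → 0ℚ < δ → Σ[ N ∈ ℕ ] 1ℚ ≤ δ * ℕ→ℚ N
archimedean (mkℚ (+ 0) _ _) (*<* (ℤ.+<+ ()))
archimedean (mkℚ ℤ.-[1+ _ ] _ _) (*<* ())
-- The witness is the denominator of `δ`, stored as its predecessor `d`: multiplying by it leaves
-- the numerator, which is at least 1.
archimedean δ@(mkℚ (+ suc a) d _) _ = suc d , toℚᵘ-cancel-≤ (begin
  mkℚᵘ ℤ.1ℤ 0                                  ≤⟨ ℚᵘ.*≤* (ℤ.+≤+ le) ⟩
  mkℚᵘ (+ suc a) d ℚᵘ.* mkℚᵘ (+ suc d) 0       ≃⟨ ℚᵘ.*-congˡ {toℚᵘ δ} (toℚᵘ-fromℚᵘ (mkℚᵘ (+ suc d) 0)) ⟨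
  toℚᵘ δ ℚᵘ.* toℚᵘ (ℕ→ℚ (suc d))               ≃⟨ toℚᵘ-homo-* δ (ℕ→ℚ (suc d)) ⟨
  toℚᵘ (δ * ℕ→ℚ (suc d))                       ∎)
  where
  open ℚᵘ.≤-Reasoning
  le : 1 ℕ.* (suc d ℕ.* 1) ℕ.≤ suc a ℕ.* suc d ℕ.* 1
  le = ℕ.≤-trans (ℕ.*-monoˡ-≤ (suc d ℕ.* 1) {1} {suc a} (ℕ.s≤s ℕ.z≤n)) (ℕ.≤-reflexive (sym (ℕ.*-assoc (suc a) (suc d) 1)))

-- From the size bounds to the approximation ratio.

-- Unlike in `Run-size`, the sets of the first phase are charged their full size `suc k`. The
-- surplus over `p` per set is the gain from a large first packing. The term with `length P` on the
-- right avoids a subtraction.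
A1-size : ∀ {p k} (I : UUSC p (suc k)) {ε′ U C} .{{_ : NonZero p}} → p ℕ.≤ k → Run I ε′ (suc k) U C →
          ∃[ P ] (IsPackingOutput I ε′ (suc k) U P ×
                  suc k ℕ.* length P ℕ.+ p ℕ.* length C ℕ.< ∣ U ∣ ℕ.+ p ℕ.+ p ℕ.* length P)
-- A run that is already in its last phase would force `p` to equal `suc k`.
A1-size I p≤k (final _) = contradiction p≤k (ℕ.n≮n _)
A1-size {p} {k} I p≤k (packing {U = U} {P} {C} _ out run) = P , out , (begin-strict
  suc k ℕ.* a ℕ.+ p ℕ.* length (P ++ C)          ≡⟨ cong (λ m → suc k ℕ.* a ℕ.+ p ℕ.* m) (length-++ P) ⟩
  suc k ℕ.* a ℕ.+ p ℕ.* (a ℕ.+ c)                ≡⟨ solve 4 (λ j a p c → j :* a :+ p :* (a :+ c) := j :* a :+ p :* a :+ p :* c) refl (suc k) a p c ⟩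
  suc k ℕ.* a ℕ.+ p ℕ.* a ℕ.+ p ℕ.* c            <⟨ ℕ.+-monoʳ-< (suc k ℕ.* a ℕ.+ p ℕ.* a) (Run-size I run) ⟩
  suc k ℕ.* a ℕ.+ p ℕ.* a ℕ.+ (u ℕ.+ p)          ≡⟨ solve 4 (λ j a p u → j :* a :+ p :* a :+ (u :+ p) := j :* a :+ u :+ p :+ p :* a) refl (suc k) a p u ⟩
  suc k ℕ.* a ℕ.+ u ℕ.+ p ℕ.+ p ℕ.* a            ≡⟨ cong (λ m → m ℕ.+ p ℕ.+ p ℕ.* a) (packing-size I (IsPackingOutput.packing out)) ⟩
  ∣ U ∣ ℕ.+ p ℕ.+ p ℕ.* a                        ∎)
  where
  open ℕ.≤-Reasoning
  open ℕ.+-*-Solver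
  a = length P
  c = length C
  u = ∣ U ─ ⋃ P ∣

-- The run bound amounts to 2a + 2c ≤ n + 1 and the cover bound to u ≤ 3o + q. Multiples are written
-- as repeated sums so that additivity of `ℕ→ℚ` suffices to transfer the result to the rationals.
combine-sizes : ∀ {n u o q a c} → 4 ℕ.* a ℕ.+ 2 ℕ.* c ℕ.< n ℕ.+ 2 ℕ.+ 2 ℕ.* a → n ℕ.≤ u →
                u ℕ.+ o ℕ.≤ 4 ℕ.* o ℕ.+ q →
                (a ℕ.+ a) ℕ.+ (c ℕ.+ c) ℕ.≤ (o ℕ.+ o ℕ.+ o) ℕ.+ (q ℕ.+ 1)
combine-sizes {n} {u} {o} {q} {a} {c} run-bound n≤u cover-bound =
  -- The added 1 turns the strict run bound into a successor, `2 ℕ.* a` completes its `4 ℕ.* a`, and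
  -- `o` completes the left side of the cover bound.
  ℕ.+-cancelʳ-≤ (1 ℕ.+ 2 ℕ.* a ℕ.+ o) _ _ (begin
    (a ℕ.+ a) ℕ.+ (c ℕ.+ c) ℕ.+ (1 ℕ.+ 2 ℕ.* a ℕ.+ o)
      ≡⟨ solve 3 (λ a c o → (a :+ a) :+ (c :+ c) :+ (con 1 :+ con 2 :* a :+ o) := (con 1 :+ (con 4 :* a :+ con 2 :* c)) :+ o) refl a c o ⟩
    suc (4 ℕ.* a ℕ.+ 2 ℕ.* c) ℕ.+ o
      ≤⟨ ℕ.+-monoˡ-≤ o run-bound ⟩
    n ℕ.+ 2 ℕ.+ 2 ℕ.* a ℕ.+ o
      ≤⟨ ℕ.+-monoˡ-≤ o (ℕ.+-monoˡ-≤ (2 ℕ.* a) (ℕ.+-monoˡ-≤ 2 n≤u)) ⟩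
    u ℕ.+ 2 ℕ.+ 2 ℕ.* a ℕ.+ o
      ≡⟨ solve 3 (λ u a o → u :+ con 2 :+ con 2 :* a :+ o := (u :+ o) :+ (con 2 :+ con 2 :* a)) refl u a o ⟩
    u ℕ.+ o ℕ.+ (2 ℕ.+ 2 ℕ.* a)
      ≤⟨ ℕ.+-monoˡ-≤ (2 ℕ.+ 2 ℕ.* a) cover-bound ⟩
    4 ℕ.* o ℕ.+ q ℕ.+ (2 ℕ.+ 2 ℕ.* a)
      ≡⟨ solve 3 (λ o q a → con 4 :* o :+ q :+ (con 2 :+ con 2 :* a) := (o :+ o :+ o) :+ (q :+ con 1) :+ (con 1 :+ con 2 :* a :+ o)) refl o q a ⟩
    (o ℕ.+ o ℕ.+ o) ℕ.+ (q ℕ.+ 1) ℕ.+ (1 ℕ.+ 2 ℕ.* a ℕ.+ o) ∎)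
  where
  open ℕ.≤-Reasoning
  open ℕ.+-*-Solver

-- Halving the size bound leaves q/2, which cancels against the main part 2q/4 of the lower bound on
-- a. What remains beyond 3o/2 is ε′q/4, absorbed by εo because q ≤ o, and the constant 1/2,
-- absorbed by δo.
ratio-bound : ∀ {ε ε′ δ o q a c} → 0ℚ ≤ ε′ → ε′ ≤ ε → 0ℚ ≤ o → q ≤ o → 1ℚ ≤ δ * o →
              (a + a) + (c + c) ≤ (o + o + o) + (q + 1ℚ) →
              (ℕ→ℚ 2 - ε′) * (+ 1 / 4) * q ≤ a →
              c ≤ (+ 3 / 2 + ε + δ) * o
ratio-bound {ε} {ε′} {δ} {o} {q} {a} {c} 0≤ε′ ε′≤ε 0≤o q≤o 1≤δo sizes approximation = begin
  c
    ≡⟨ solve 2 (λ a c → c := con ½ :* ((a :+ a) :+ (c :+ c)) :- a) refl a c ⟩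
  ½ * ((a + a) + (c + c)) - a
    ≤⟨ +-mono-≤ (*-monoˡ-≤-nonNeg ½ sizes) (neg-antimono-≤ approximation) ⟩
  ½ * ((o + o + o) + (q + 1ℚ)) - (ℕ→ℚ 2 - ε′) * (+ 1 / 4) * q
    ≡⟨ solve 3 (λ o q ε′ → con ½ :* ((o :+ o :+ o) :+ (q :+ con 1ℚ)) :- (con (ℕ→ℚ 2) :- ε′) :* con (+ 1 / 4) :* q
                  := con (+ 3 / 2) :* o :+ con (+ 1 / 4) :* (ε′ :* q) :+ con ½) refl o q ε′ ⟩
  + 3 / 2 * o + + 1 / 4 * (ε′ * q) + ½
    ≤⟨ +-mono-≤ (+-monoʳ-≤ (+ 3 / 2 * o) ¼ε′q≤εo) (≤-trans (from-yes (½ ≤? 1ℚ)) 1≤δo) ⟩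
  + 3 / 2 * o + ε * o + δ * o
    ≡⟨ solve 3 (λ o ε δ → con (+ 3 / 2) :* o :+ ε :* o :+ δ :* o := (con (+ 3 / 2) :+ ε :+ δ) :* o) refl o ε δ ⟩
  (+ 3 / 2 + ε + δ) * o ∎
  where
  open ≤-Reasoning
  open +-*-Solver
  instance
    _ = nonNegative 0≤ε′
    _ = nonNegative 0≤o
    ε′o≥0 = nonNegative (subst (_≤ ε′ * o) (*-zeroˡ o) (*-monoʳ-≤-nonNeg o 0≤ε′))
  ¼ε′q≤εo : + 1 / 4 * (ε′ * q) ≤ ε * o
  ¼ε′q≤εo = begin
    + 1 / 4 * (ε′ * q)   ≤⟨ *-monoˡ-≤-nonNeg (+ 1 / 4) (*-monoˡ-≤-nonNeg ε′ q≤o) ⟩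
    + 1 / 4 * (ε′ * o)   ≤⟨ *-monoʳ-≤-nonNeg (ε′ * o) (from-yes (+ 1 / 4 ≤? 1ℚ)) ⟩
    1ℚ * (ε′ * o)        ≡⟨ *-identityˡ (ε′ * o) ⟩
    ε′ * o               ≤⟨ *-monoʳ-≤-nonNeg o ε′≤ε ⟩
    ε * o                ∎

corollary2p1 : ∀ (ε : ℚ) → 0ℚ < ε →
    ∃[ ε₀ ] (0ℚ < ε₀ ×
    (∀ (ε′ : ℚ) → 0ℚ < ε′ → ε′ ≤ ε₀ →
    IsAsymptoticApproximation (A1 2 4 ε′) (+ 3 / 2 + ε)))
-- The threshold `ε` itself is small enough, since the accuracy loss is only a quarter of `ε′` per
-- set of the optimal packing's bound `length O`. The number `N` makes `δ` times the size of the
-- optimum at least 1, which pays for the additive constant.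
corollary2p1 ε 0<ε = ε , 0<ε , λ ε′ 0<ε′ ε′≤ε → record
  { feasible = λ I C → Run⇒IsCover I
  ; limsup≤  = λ δ 0<δ → let N , 1≤δN = archimedean δ 0<δ in
      N , λ I O C O-minimum run N≤∣O∣ → bound ε′ 0<ε′ ε′≤ε δ 0<δ N 1≤δN I O C (proj₁ O-minimum) run N≤∣O∣
  }
  where
  bound : ∀ ε′ → 0ℚ < ε′ → ε′ ≤ ε → ∀ δ → 0ℚ < δ → ∀ N → 1ℚ ≤ δ * ℕ→ℚ N →
          ∀ (I : UUSC 2 4) O C → IsCover I O → Run I ε′ 4 ⊤ C → N ℕ.≤ length O →
          ℕ→ℚ (length C) ≤ (+ 3 / 2 + ε + δ) * ℕ→ℚ (length O)
  bound ε′ 0<ε′ ε′≤ε δ 0<δ N 1≤δN I O C O-cover run N≤o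
    with A1-size I (from-yes (2 ℕ.≤? 3)) run | packing-from-cover I O (IsCover.available O-cover)
  ... | P , out , run-bound | Q , π , q≤o , cover-bound =
    ratio-bound (<⇒≤ 0<ε′) ε′≤ε (ℕ→ℚ-mono-≤ {b = o} ℕ.z≤n) (ℕ→ℚ-mono-≤ q≤o)
      (≤-trans 1≤δN (*-monoˡ-≤-nonNeg δ {{nonNegative (<⇒≤ 0<δ)}} (ℕ→ℚ-mono-≤ N≤o)))
      (subst₂ _≤_ (homo-lhs a c) (homo-rhs o q)
        (ℕ→ℚ-mono-≤ (combine-sizes {a = a} {c} run-bound n≤∣⋃O∣ cover-bound)))
      -- Everything is uncovered when phase 4 starts, so the packing extracted from `O` competes
      -- with the one chosen by the algorithm.
      (IsPackingOutput.approximation out Q (IsPacking-⊆ I ⊆⊤ π))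
    where
    a = length P
    c = length C
    o = length O
    q = length Q
    n≤∣⋃O∣ : ∣ ⊤ {n I} ∣ ℕ.≤ ∣ ⋃ O ∣
    n≤∣⋃O∣ = p⊆q⇒∣p∣≤∣q∣ {p = ⊤ {n I}} (λ {x} _ → IsCover.covers O-cover x)
    homo-lhs : ∀ a c →
      ℕ→ℚ ((a ℕ.+ a) ℕ.+ (c ℕ.+ c)) ≡ (ℕ→ℚ a + ℕ→ℚ a) + (ℕ→ℚ c + ℕ→ℚ c)
    homo-lhs a c = trans (ℕ→ℚ-homo-+ (a ℕ.+ a) (c ℕ.+ c)) (cong₂ _+_ (ℕ→ℚ-homo-+ a a) (ℕ→ℚ-homo-+ c c))
    homo-rhs : ∀ o q →
      ℕ→ℚ ((o ℕ.+ o ℕ.+ o) ℕ.+ (q ℕ.+ 1)) ≡ (ℕ→ℚ o + ℕ→ℚ o + ℕ→ℚ o) + (ℕ→ℚ q + 1ℚ)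
    homo-rhs o q = trans (ℕ→ℚ-homo-+ (o ℕ.+ o ℕ.+ o) (q ℕ.+ 1)) (cong₂ _+_
      (trans (ℕ→ℚ-homo-+ (o ℕ.+ o) o) (cong (_+ ℕ→ℚ o) (ℕ→ℚ-homo-+ o o))) (ℕ→ℚ-homo-+ q 1))
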